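{- Any online algorithm that has the MRU property is $4$ access-competitive: for every request sequence $\sigma$, the total access cost of the algorithm on $\sigma$ is at most $4\cdot\mathrm{cost}(\textsc{Opt}(\sigma))$.
   Context: Self-adjusting complete tree model: a set $V$ of $n$ items is stored in a complete binary tree of $n$ servers, one item per server; the root has depth $0$ and an item's depth is that of its hosting server. Requests $\sigma=(\sigma^{(1)},\sigma^{(2)},\dots)$ to items are revealed online and originate at the root. Serving a request to an item at depth $d$ costs $d$ (access cost); a swap, exchanging the items of a server and its parent, costs $1$ (adjustment cost). $\mathrm{cost}(\textsc{Opt}(\sigma))$ is the total access plus adjustment cost of an optimal offline algorithm that knows $\sigma$ in advance. The rank of item $v$ at time $t$ is the number of distinct items requested since the last request of $v$ before $t$, including $v$. A tree is an MRU tree at time $t$ if every item $v$ has depth exactly $\lfloor\log_2 v.\mathrm{rank}\rfloor$. An online algorithm has the MRU property if the tree it maintains is an MRU tree at every time $t$. -}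

module Defs where

open import Data.Nat using (ℕ; zero; suc; _+_; _∸_; _≤_; _<_)
open import Data.Nat.Properties using (≤-<-trans; ≤-trans; m∸n≤m)
open import Data.Nat.DivMod using (_/_; m/n≤m)
open import Relation.Binary.PropositionalEquality using (_≡_)
open import Data.Nat.Logarithm using (⌊log₂_⌋)
open import Data.Fin using (Fin; toℕ; fromℕ<; _≟_)
open import Data.Fin.Properties using (toℕ<n)
open import Data.Fin.Permutation using (Permutation′; _⟨$⟩ʳ_; transpose)
open import Data.List using (List; []; _∷_; _++_; [_]; reverse; length; deduplicate)
open import Data.List.Membership.Propositional using (_∈_)
open import Relation.Nullary using (yes; no)
open import Function using (_∘_)

-- Servers and items are both indexed by Fin n.
-- Server k (0-indexed) is node k+1 of the complete binary tree in heap order: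
-- the root is server 0, the parent of server k ≥ 1 is server ⌊(k-1)/2⌋,
-- and the depth of server k is ⌊log₂ (k+1)⌋.
depth : ∀ {n} → Fin n → ℕ
depth s = ⌊log₂ (suc (toℕ s)) ⌋

-- A tree (configuration): a bijection from items to the servers hosting them
-- (one item per server).
Tree : ℕ → Set
Tree n = Permutation′ n

itemDepth : ∀ {n} → Tree n → Fin n → ℕ
itemDepth T v = depth (T ⟨$⟩ʳ v)

-- A swap is designated by a non-root server; it exchanges the items of that
-- server and its parent.
record Swap (n : ℕ) : Set where
  constructor swapAt
  field
    server  : Fin n
    nonRoot : 1 ≤ toℕ server

parentIdx<n : ∀ {n} (s : Fin n) → (toℕ s ∸ 1) / 2 < n
parentIdx<n {n} s = ≤-<-trans (≤-trans (m/n≤m (toℕ s ∸ 1) 2) (m∸n≤m (toℕ s) 1)) (toℕ<n s)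

parent : ∀ {n} → Swap n → Fin n
parent sw = fromℕ< (parentIdx<n (Swap.server sw))

applySwap : ∀ {n} → (Fin n → Fin n) → Swap n → (Fin n → Fin n)
applySwap loc sw = (transpose (Swap.server sw) (parent sw) ⟨$⟩ʳ_) ∘ loc

applySwaps : ∀ {n} → (Fin n → Fin n) → List (Swap n) → (Fin n → Fin n)
applySwaps loc []         = loc
applySwaps loc (sw ∷ sws) = applySwaps (applySwap loc sw) sws

-- Histories are lists of requests, oldest first.
-- segment v xs (xs = history, most recent first): the requests from the most
-- recent one back to and including the last request of v.
segment : ∀ {n} → Fin n → List (Fin n) → List (Fin n)
segment v [] = []
segment v (x ∷ xs) with x ≟ v
... | yes _ = x ∷ []
... | no  _ = x ∷ segment v xs

rank : ∀ {n} → List (Fin n) → Fin n → ℕ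
rank h v = length (deduplicate _≟_ (segment v (reverse h)))

IsMRU : ∀ {n} → List (Fin n) → Tree n → Set
IsMRU h T = ∀ v → itemDepth T v ≡ ⌊log₂ (rank h v) ⌋

-- An online algorithm: the tree used to serve the next request is determined
-- by the requests revealed so far (oldest first); alg [] is the initial tree.
OnlineAlg : ℕ → Set
OnlineAlg n = List (Fin n) → Tree n

-- MRU property w.r.t. a (virtual) initial history `init` fixing the initial
-- recency order: at every time, the tree is MRU for the ranks computed from
-- init followed by the requests so far.
HasMRU : ∀ {n} → List (Fin n) → OnlineAlg n → Set
HasMRU init alg = ∀ p → IsMRU (init ++ p) (alg p)

accessCostFrom : ∀ {n} → OnlineAlg n → List (Fin n) → List (Fin n) → ℕ
accessCostFrom alg p []       = 0
accessCostFrom alg p (x ∷ xs) = itemDepth (alg p) x + accessCostFrom alg (p ++ [ x ]) xs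

accessCost : ∀ {n} → OnlineAlg n → List (Fin n) → ℕ
accessCost alg σ = accessCostFrom alg [] σ

-- An arbitrary (offline) algorithm: before serving the t-th request
-- (t = 0,1,...) it performs the list of swaps sched t; cost = swaps + access.
offlineCostFrom : ∀ {n} → (Fin n → Fin n) → (ℕ → List (Swap n)) → ℕ → List (Fin n) → ℕ
offlineCostFrom loc sched t []       = 0
offlineCostFrom loc sched t (x ∷ xs) =
  length (sched t) + depth (applySwaps loc (sched t) x)
    + offlineCostFrom (applySwaps loc (sched t)) sched (suc t) xs

offlineCost : ∀ {n} → (Fin n → Fin n) → (ℕ → List (Swap n)) → List (Fin n) → ℕ
offlineCost loc sched σ = offlineCostFrom loc sched 0 σ

{-# OPTIONS --safe #-}
-- Let b v be the depth of v in the offline tree, and let B v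
-- count the items u requested more recently than v that lie deeper than v there.  Take
-- Φ = ∏ (2 ^ b v + B v), so that log₂ Φ plays the role of the usual potential and
-- everything stays in ℕ; ∏ 2 ^ b v is a constant Φ₀, Φ ≥ Φ₀ always, and Φ = Φ₀ at the
-- start because B = 0 in an MRU tree.  Requesting an item of rank r at
-- offline depth d multiplies Φ by at most 2 ^ (4 d) / 2 ^ ⌊log₂ r⌋: the weight of the
-- item drops from about r to 2 ^ d, and each of the d levels above it gains at most
-- (1 + 1 / 2 ^ j) ^ 2 ^ j ≤ 4.  A swap multiplies Φ by at most 16: the two moved
-- items at most double their weight, and the parent level gains at most a factor 4.
module Submission where

open import Defs
open import Data.Nat using (ℕ; _≤_; _*_)
open import Data.Fin using (Fin)
open import Data.List using (List; [])
open import Data.List.Membership.Propositional using (_∈_)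
open import Data.Fin.Permutation using (_⟨$⟩ʳ_)

open import Data.Nat using (zero; suc; _+_; _∸_; _^_; _<_; z≤n; s≤s; s≤s⁻¹; NonZero; ⌊_/2⌋; _<?_; _≤?_) renaming (_≟_ to _≟ℕ_)
open import Data.Nat.Properties hiding (_≟_)
open import Algebra.Properties.CommutativeSemigroup *-commutativeSemigroup using (x∙yz≈y∙xz)
open import Data.Nat.DivMod using (_/_; m/n≡1+[m∸n]/n)
open import Data.Nat.Induction using (<-rec)
open import Data.Nat.ListAction using (product)
open import Data.Nat.ListAction.Properties using (product-↭; product≢0)
open import Data.Nat.Logarithm using (⌊log₂_⌋; ⌊log₂⌋-mono-≤; ⌊log₂[2^n]⌋≡n; ⌊log₂⌊n/2⌋⌋≡⌊log₂n⌋∸1)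
open import Data.Nat.Tactic.RingSolver using (solve-∀)
open import Data.Fin using (toℕ)
open import Data.Fin.Permutation using (_⟨$⟩ˡ_; _∘ₚ_; transpose; inverseˡ; inverseʳ)
import Data.Fin.Permutation.Components as PC
open import Data.Fin.Properties using (_≟_; toℕ-injective; toℕ-fromℕ<)
open import Data.List using (_∷_; _++_; [_]; map; filter; length; reverse; applyUpTo; allFin; deduplicate)
open import Data.List.Properties using (length-++; length-map; length-applyUpTo; map-∘; ++-assoc; reverse-++)
open import Data.List.Membership.DecPropositional using (_∈?_)
open import Data.List.Membership.Propositional using (_∉_)
open import Data.List.Membership.Propositional.Properties
open import Data.List.Membership.Propositional.Properties.WithK using (unique∧set⇒bag)
open import Data.List.Relation.Binary.BagAndSetEquality using (∼bag⇒↭)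
open import Data.List.Relation.Binary.Permutation.Propositional using (_↭_)
import Data.List.Relation.Binary.Permutation.Propositional.Properties as Perm
open import Data.List.Relation.Binary.Subset.Propositional using (_⊆_)
open import Data.List.Relation.Unary.All as All using ()
open import Data.List.Relation.Unary.AllPairs using ([]; _∷_)
open import Data.List.Relation.Unary.Any using (here; there)
open import Data.List.Relation.Unary.Unique.Propositional using (Unique)
open import Data.List.Relation.Unary.Unique.Propositional.Properties as Unique using (allFin⁺)
open import Data.List.Relation.Unary.Unique.DecPropositional.Properties using (deduplicate-!)
open import Data.Bool using (if_then_else_)
open import Data.Product using (_×_; _,_; proj₁; proj₂)
open import Data.Sum using (_⊎_; inj₁; inj₂; [_,_]′)
open import Function using (_∘_; id; mk⇔)
open import Function.Bundles using (Injection)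
open import Function.Properties.Inverse using (↔⇒↣)
open import Level using (0ℓ)
open import Relation.Binary.PropositionalEquality using (_≡_; _≢_; refl; sym; trans; cong; subst; subst₂; module ≡-Reasoning)
open import Relation.Nullary using (yes; no; ¬_; does; contradiction; ¬?; _×-dec_)
open import Relation.Unary using (Pred; Decidable)

private variable
  n : ℕ
  A C : Set

-- Binary logarithms and depths in heap order.

n/2≡⌊n/2⌋ : ∀ k → k / 2 ≡ ⌊ k /2⌋
n/2≡⌊n/2⌋ zero          = refl
n/2≡⌊n/2⌋ (suc zero)    = refl
n/2≡⌊n/2⌋ (suc (suc k)) =
  trans (m/n≡1+[m∸n]/n {suc (suc k)} {2} (s≤s (s≤s z≤n))) (cong suc (n/2≡⌊n/2⌋ k))

⌊log₂2+n⌋≡1+⌊log₂1+⌊n/2⌋⌋ : ∀ k → ⌊log₂ (2 + k) ⌋ ≡ suc ⌊log₂ (suc ⌊ k /2⌋) ⌋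
⌊log₂2+n⌋≡1+⌊log₂1+⌊n/2⌋⌋ k = begin-equality
  ⌊log₂ (2 + k) ⌋               ≡⟨ m+[n∸m]≡n (⌊log₂⌋-mono-≤ {2} {2 + k} (s≤s (s≤s z≤n))) ⟨
  suc (⌊log₂ (2 + k) ⌋ ∸ 1)     ≡⟨ cong suc (⌊log₂⌊n/2⌋⌋≡⌊log₂n⌋∸1 (2 + k)) ⟨
  suc ⌊log₂ (suc ⌊ k /2⌋) ⌋     ∎
  where open ≤-Reasoning

-- In one-based numbering the parent of a node carries half its index, rounded down, and halving
-- lowers the logarithm by one.
heap-depth : ∀ k → 1 ≤ k → ⌊log₂ (suc k) ⌋ ≡ suc ⌊log₂ (suc ((k ∸ 1) / 2)) ⌋
heap-depth (suc k) _ = trans (⌊log₂2+n⌋≡1+⌊log₂1+⌊n/2⌋⌋ k)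
  (cong (λ i → suc ⌊log₂ (suc i) ⌋) (sym (n/2≡⌊n/2⌋ k)))

-- Strong induction along halving. The form `suc m` avoids zero, where `⌊log₂ 0 ⌋` is `0` and the
-- inequality would read `1 ≤ 0`.
2^⌊log₂n⌋≤n : ∀ m → 2 ^ ⌊log₂ (suc m) ⌋ ≤ suc m
2^⌊log₂n⌋≤n = <-rec _ step
  where
  open ≤-Reasoning
  step : ∀ m → (∀ {k} → k < m → 2 ^ ⌊log₂ (suc k) ⌋ ≤ suc k) → 2 ^ ⌊log₂ (suc m) ⌋ ≤ suc m
  step zero    rec = ≤-refl
  step (suc k) rec = begin
    2 ^ ⌊log₂ (2 + k) ⌋               ≡⟨ cong (2 ^_) (⌊log₂2+n⌋≡1+⌊log₂1+⌊n/2⌋⌋ k) ⟩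
    2 * 2 ^ ⌊log₂ (suc ⌊ k /2⌋) ⌋     ≤⟨ *-monoʳ-≤ 2 (rec (s≤s (⌊n/2⌋≤n k))) ⟩
    2 * suc ⌊ k /2⌋                   ≡⟨ double ⌊ k /2⌋ ⟩
    2 + (⌊ k /2⌋ + ⌊ k /2⌋)           ≤⟨ +-monoʳ-≤ 2 (+-monoʳ-≤ ⌊ k /2⌋ (⌊n/2⌋≤⌈n/2⌉ k)) ⟩
    2 + (⌊ k /2⌋ + _)                 ≡⟨ cong (2 +_) (⌊n/2⌋+⌈n/2⌉≡n k) ⟩
    2 + k                             ∎
    where
    double : ∀ a → 2 * suc a ≡ 2 + (a + a)
    double = solve-∀

n<2^[1+⌊log₂n⌋] : ∀ m → m < 2 ^ suc ⌊log₂ m ⌋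
n<2^[1+⌊log₂n⌋] m = ≰⇒> λ 2^≤m →
  1+n≰n (subst (_≤ ⌊log₂ m ⌋) (⌊log₂[2^n]⌋≡n _) (⌊log₂⌋-mono-≤ 2^≤m))

^-cancelʳ-≤ : ∀ k l → 2 ^ k ≤ 2 ^ l → k ≤ l
^-cancelʳ-≤ k l p = subst₂ _≤_ (⌊log₂[2^n]⌋≡n k) (⌊log₂[2^n]⌋≡n l) (⌊log₂⌋-mono-≤ p)

-- Counting

-- Cut one occurrence of the head `x` out of `ys`; by uniqueness the tail of `xs` avoids `x`, so it
-- still fits into what is left.
unique-⊆⇒length≤ : ∀ {xs ys : List A} → Unique xs → xs ⊆ ys → length xs ≤ length ys
unique-⊆⇒length≤ {xs = []}     _          _     = z≤n
unique-⊆⇒length≤ {xs = x ∷ xs} (x∉ ∷ uxs) xs⊆ys with ∈-∃++ (xs⊆ys (here refl))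
... | as , bs , refl = begin
  suc (length xs)                ≤⟨ s≤s (unique-⊆⇒length≤ uxs xs⊆) ⟩
  suc (length (as ++ bs))        ≡⟨ cong suc (length-++ as) ⟩
  suc (length as + length bs)    ≡⟨ +-suc (length as) (length bs) ⟨
  length as + length (x ∷ bs)    ≡⟨ length-++ as ⟨
  length (as ++ x ∷ bs)          ∎
  where
  open ≤-Reasoning
  xs⊆ : xs ⊆ as ++ bs
  xs⊆ y∈xs with ∈-++⁻ as (xs⊆ys (there y∈xs))
  ... | inj₁ y∈as          = ∈-++⁺ˡ y∈as
  ... | inj₂ (here refl)   = contradiction refl (All.lookup x∉ y∈xs)
  ... | inj₂ (there y∈bs)  = ∈-++⁺ʳ as y∈bs

count : {P : Pred (Fin n) 0ℓ} → Decidable P → ℕ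
count P? = length (filter P? (allFin _))

module _ {P : Pred (Fin n) 0ℓ} (P? : Decidable P) where

  ∈-filter-allFin : ∀ {v} → P v → v ∈ filter P? (allFin n)
  ∈-filter-allFin Pv = ∈-filter⁺ P? (∈-allFin _) Pv

  count-injection : (f : Fin n → C) → (∀ {u v} → f u ≡ f v → u ≡ v) →
                    (ys : List C) → (∀ v → P v → f v ∈ ys) → count P? ≤ length ys
  count-injection f f-inj ys f∈ = begin
    count P?                               ≡⟨ length-map f (filter P? (allFin n)) ⟨
    length (map f (filter P? (allFin n)))  ≤⟨ unique-⊆⇒length≤ (Unique.map⁺ f-inj (Unique.filter⁺ P? (allFin⁺ n))) ⊆ys ⟩
    length ys                              ∎
    where
    open ≤-Reasoning
    ⊆ys : map f (filter P? (allFin n)) ⊆ ys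
    ⊆ys y∈ with ∈-map⁻ f y∈
    ... | v , v∈ , refl = f∈ v (proj₂ (∈-filter⁻ P? {xs = allFin n} v∈))

  count-⊆ : ∀ ys → (∀ v → P v → v ∈ ys) → count P? ≤ length ys
  count-⊆ = count-injection id id

  -- The one-based server index is an injective code for items, so a range of `k` indices holds at
  -- most `k` of them.
  count-interval : (π : Tree n) → ∀ lo k →
                   (∀ v → P v → lo ≤ suc (toℕ (π ⟨$⟩ʳ v)) × suc (toℕ (π ⟨$⟩ʳ v)) < lo + k) →
                   count P? ≤ k
  count-interval π lo k bounds = begin
    count P?                        ≤⟨ count-injection (λ v → suc (toℕ (π ⟨$⟩ʳ v)))
                                         (Injection.injective (↔⇒↣ π) ∘ toℕ-injective ∘ suc-injective)
                                         (applyUpTo (lo +_) k) mem ⟩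
    length (applyUpTo (lo +_) k)    ≡⟨ length-applyUpTo (lo +_) k ⟩
    k                               ∎
    where
    open ≤-Reasoning
    mem : ∀ v → P v → suc (toℕ (π ⟨$⟩ʳ v)) ∈ applyUpTo (lo +_) k
    mem v Pv with bounds v Pv
    ... | lo≤ , <lo+k = subst (_∈ applyUpTo (lo +_) k) (m+[n∸m]≡n lo≤)
      (∈-applyUpTo⁺ (lo +_) (+-cancelˡ-< lo _ k (subst (_< lo + k) (sym (m+[n∸m]≡n lo≤)) <lo+k)))

-- Depth `j` means a one-based index in the half-open interval from `2 ^ j` to `2 ^ suc j`. It is
-- only an upper bound since the last level may be partly filled.
level-size : (π : Tree n) → ∀ j → count (λ v → itemDepth π v ≟ℕ j) ≤ 2 ^ j
level-size π j = count-interval _ π (2 ^ j) (2 ^ j) λ { v refl →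
  2^⌊log₂n⌋≤n _ , subst (suc (toℕ (π ⟨$⟩ʳ v)) <_) (cong (2 ^ itemDepth π v +_) (+-identityʳ _)) (n<2^[1+⌊log₂n⌋] _) }

top-size : (π : Tree n) → ∀ d → count (λ v → itemDepth π v ≤? d) ≤ 2 ^ suc d ∸ 1
top-size π d = count-interval _ π 1 (2 ^ suc d ∸ 1) λ v depth≤d →
  s≤s z≤n , subst (suc (toℕ (π ⟨$⟩ʳ v)) <_) (sym (m+[n∸m]≡n (m^n>0 2 (suc d))))
    (<-≤-trans (n<2^[1+⌊log₂n⌋] _) (^-monoʳ-≤ 2 (s≤s depth≤d)))

-- Products

Π[_] : List A → (A → ℕ) → ℕ
Π[ xs ] f = product (map f xs)

Π : (Fin n → ℕ) → ℕ
Π f = Π[ allFin _ ] f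

Π-mono : ∀ (xs : List A) {f g : A → ℕ} → (∀ {v} → v ∈ xs → f v ≤ g v) → Π[ xs ] f ≤ Π[ xs ] g
Π-mono []       f≤g = ≤-refl
Π-mono (x ∷ xs) f≤g = *-mono-≤ (f≤g (here refl)) (Π-mono xs (f≤g ∘ there))

module _ {f g : A → ℕ} where
  open ≤-Reasoning

  -- A division-free way to say that the product changes by at most `c / a` when only the factor at
  -- `x` does.
  Π-point : ∀ {x xs} a c → x ∈ xs → Unique xs → a * f x ≤ c * g x →
            (∀ v → v ≢ x → f v ≤ g v) → a * Π[ xs ] f ≤ c * Π[ xs ] g
  Π-point {x} {_ ∷ xs} a c (here refl) (x∉ ∷ _) at-x off-x = begin
    a * (f x * Π[ xs ] f)  ≡⟨ *-assoc a _ _ ⟨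
    a * f x * Π[ xs ] f    ≤⟨ *-mono-≤ at-x (Π-mono xs λ v∈ → off-x _ (All.lookup x∉ v∈ ∘ sym)) ⟩
    c * g x * Π[ xs ] g    ≡⟨ *-assoc c _ _ ⟩
    c * (g x * Π[ xs ] g)  ∎
  Π-point {x} {y ∷ xs} a c (there x∈) (y∉ ∷ uxs) at-x off-x = begin
    a * (f y * Π[ xs ] f)  ≡⟨ x∙yz≈y∙xz a (f y) _ ⟩
    f y * (a * Π[ xs ] f)  ≤⟨ *-mono-≤ (off-x y (All.lookup y∉ x∈)) (Π-point a c x∈ uxs at-x off-x) ⟩
    g y * (c * Π[ xs ] g)  ≡⟨ x∙yz≈y∙xz (g y) c _ ⟩
    c * (g y * Π[ xs ] g)  ∎

  module _ {P : Pred A 0ℓ} (P? : Decidable P) (off : ∀ v → ¬ P v → f v ≤ g v) where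

    Π-double : (∀ v → P v → f v ≤ 2 * g v) →
               ∀ xs → Π[ xs ] f ≤ 2 ^ length (filter P? xs) * Π[ xs ] g
    Π-double on []       = ≤-refl
    Π-double on (x ∷ xs) with P? x | Π-double on xs
    ... | yes Px | ih = begin
      f x * Π[ xs ] f                    ≤⟨ *-mono-≤ (on x Px) ih ⟩
      2 * g x * (2 ^ k * Π[ xs ] g)      ≡⟨ regroup (g x) (2 ^ k) _ ⟩
      2 * 2 ^ k * (g x * Π[ xs ] g)      ∎
      where
      k = length (filter P? xs)
      regroup : ∀ a b c → 2 * a * (b * c) ≡ 2 * b * (a * c)
      regroup = solve-∀
    ... | no ¬Px | ih = begin
      f x * Π[ xs ] f                    ≤⟨ *-mono-≤ (off x ¬Px) ih ⟩
      g x * (2 ^ k * Π[ xs ] g)          ≡⟨ x∙yz≈y∙xz (g x) (2 ^ k) _ ⟩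
      2 ^ k * (g x * Π[ xs ] g)          ∎
      where
      k = length (filter P? xs)

    -- Telescoping: (a + 1) / a ≤ ((m + 1) / m)² as long as m + 1 ≤ 2 a.
    Π-increment-telescope : ∀ N → (∀ v → P v → N ≤ g v) → (∀ v → P v → f v ≤ suc (g v)) →
      ∀ xs m → m + length (filter P? xs) ≤ 2 * N →
      m * m * Π[ xs ] f ≤ (m + length (filter P? xs)) * (m + length (filter P? xs)) * Π[ xs ] g
    Π-increment-telescope N N≤g on []       m m+k≤2N rewrite +-identityʳ m = ≤-refl
    Π-increment-telescope N N≤g on (x ∷ xs) m m+k≤2N with P? x
    ... | yes Px rewrite +-suc m (length (filter P? xs)) = begin
      m * m * (f x * Π[ xs ] f)              ≡⟨ *-assoc (m * m) (f x) _ ⟨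
      m * m * f x * Π[ xs ] f                ≤⟨ *-monoˡ-≤ _ factor ⟩
      suc m * suc m * g x * Π[ xs ] f        ≡⟨ regroup (suc m * suc m) (g x) _ ⟩
      g x * (suc m * suc m * Π[ xs ] f)      ≤⟨ *-monoʳ-≤ (g x) (Π-increment-telescope N N≤g on xs (suc m) m+k≤2N) ⟩
      g x * (suc M * suc M * Π[ xs ] g)      ≡⟨ x∙yz≈y∙xz (g x) (suc M * suc M) _ ⟩
      suc M * suc M * (g x * Π[ xs ] g)      ∎
      where
      M = m + length (filter P? xs)
      regroup : ∀ a b c → a * b * c ≡ b * (a * c)
      regroup = solve-∀
      expand₁ : ∀ m a → m * m * suc a ≡ m * m * a + m * m
      expand₁ = solve-∀
      expand₂ : ∀ m a → m * m * a + m * (2 * a) + a ≡ suc m * suc m * a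
      expand₂ = solve-∀
      factor : m * m * f x ≤ suc m * suc m * g x
      factor = begin
        m * m * f x                            ≤⟨ *-monoʳ-≤ (m * m) (on x Px) ⟩
        m * m * suc (g x)                      ≡⟨ expand₁ m (g x) ⟩
        -- Since `m ≤ 2 * N ≤ 2 * g x`, the excess `m * m` is covered by the mixed term of
        -- `suc m * suc m * g x`.
        m * m * g x + m * m                    ≤⟨ +-monoʳ-≤ (m * m * g x) (*-monoʳ-≤ m (≤-trans (≤-trans (m≤m+n m _) (≤-trans (n≤1+n M) m+k≤2N)) (*-monoʳ-≤ 2 (N≤g x Px)))) ⟩
        m * m * g x + m * (2 * g x)            ≤⟨ m≤m+n _ (g x) ⟩
        m * m * g x + m * (2 * g x) + g x      ≡⟨ expand₂ m (g x) ⟩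
        suc m * suc m * g x                    ∎
    ... | no ¬Px = begin
      m * m * (f x * Π[ xs ] f)        ≡⟨ x∙yz≈y∙xz (m * m) (f x) _ ⟩
      f x * (m * m * Π[ xs ] f)        ≤⟨ *-mono-≤ (off x ¬Px) (Π-increment-telescope N N≤g on xs m m+k≤2N) ⟩
      g x * (M * M * Π[ xs ] g)        ≡⟨ x∙yz≈y∙xz (g x) (M * M) _ ⟩
      M * M * (g x * Π[ xs ] g)        ∎
      where
      M = m + length (filter P? xs)

    -- The factor 4 bounds (1 + 1 / N) ^ N.
    Π-increment : ∀ N .{{_ : NonZero N}} → (∀ v → P v → N ≤ g v) → (∀ v → P v → f v ≤ suc (g v)) →
                  ∀ xs → length (filter P? xs) ≤ N → Π[ xs ] f ≤ 4 * Π[ xs ] g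
    Π-increment N N≤g on xs k≤N = *-cancelˡ-≤ (N * N) {{m*n≢0 N N}} (begin
      N * N * Π[ xs ] f              ≤⟨ Π-increment-telescope N N≤g on xs N (≤-trans N+k≤N+N (≤-reflexive (double N))) ⟩
      (N + k) * (N + k) * Π[ xs ] g  ≤⟨ *-monoˡ-≤ _ (*-mono-≤ N+k≤N+N N+k≤N+N) ⟩
      (N + N) * (N + N) * Π[ xs ] g  ≡⟨ regroup N _ ⟩
      N * N * (4 * Π[ xs ] g)        ∎)
      where
      k = length (filter P? xs)
      N+k≤N+N : N + k ≤ N + N
      N+k≤N+N = +-monoʳ-≤ N k≤N
      double : ∀ a → a + a ≡ 2 * a
      double = solve-∀
      regroup : ∀ a b → (a + a) * (a + a) * b ≡ a * a * (4 * b)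
      regroup = solve-∀

-- The image list under `π` and `allFin n` are both duplicate-free with the same members, hence
-- permutations of each other.
Π-permute : (π : Tree n) (f : Fin n → ℕ) → Π (f ∘ (π ⟨$⟩ʳ_)) ≡ Π f
Π-permute {n} π f = begin
  Π (f ∘ (π ⟨$⟩ʳ_))                                 ≡⟨ cong product (map-∘ (allFin n)) ⟩
  Π[ map (π ⟨$⟩ʳ_) (allFin n) ] f                   ≡⟨ product-↭ (Perm.map⁺ f permuted) ⟩
  Π f                                               ∎
  where
  open ≡-Reasoning
  permuted : map (π ⟨$⟩ʳ_) (allFin n) ↭ allFin n
  permuted = ∼bag⇒↭ (unique∧set⇒bag (Unique.map⁺ (Injection.injective (↔⇒↣ π)) (allFin⁺ n)) (allFin⁺ n)
    (mk⇔ (λ _ → ∈-allFin _) (λ _ → onto _)))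
    where
    onto : ∀ s → s ∈ map (π ⟨$⟩ʳ_) (allFin n)
    onto s = subst (_∈ map (π ⟨$⟩ʳ_) (allFin n)) (inverseʳ π) (∈-map⁺ (π ⟨$⟩ʳ_) (∈-allFin (π ⟨$⟩ˡ s)))

-- Adding one on a decidable set.

bump : {P : Pred A 0ℓ} → Decidable P → (A → ℕ) → A → ℕ
bump P? f v = if does (P? v) then suc (f v) else f v

module _ {P : Pred A 0ℓ} (P? : Decidable P) (f : A → ℕ) where

  f≤bump : ∀ v → f v ≤ bump P? f v
  f≤bump v with P? v
  ... | yes _ = n≤1+n _
  ... | no  _ = ≤-refl

  bump≤suc : ∀ v → bump P? f v ≤ suc (f v)
  bump≤suc v with P? v
  ... | yes _ = ≤-refl
  ... | no  _ = n≤1+n _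

  bump-on : ∀ {v} → P v → suc (f v) ≤ bump P? f v
  bump-on {v} Pv with P? v
  ... | yes _  = ≤-refl
  ... | no ¬Pv = contradiction Pv ¬Pv

  bump-off : ∀ {v} → ¬ P v → bump P? f v ≤ f v
  bump-off {v} ¬Pv with P? v
  ... | yes Pv = contradiction Pv ¬Pv
  ... | no  _  = ≤-refl

bump-mono : {P Q : Pred A 0ℓ} (P? : Decidable P) (Q? : Decidable Q) (f : A → ℕ) →
            ∀ {v} → (P v → Q v) → bump P? f v ≤ bump Q? f v
bump-mono P? Q? f {v} P⇒Q with P? v
... | yes Pv = bump-on Q? f (P⇒Q Pv)
... | no  _  = f≤bump Q? f v

-- Values of a transposition.

transpose-matchˡ : (i k : Fin n) → PC.transpose i k i ≡ k
transpose-matchˡ i k with i ≟ i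
... | yes _  = refl
... | no i≢i = contradiction refl i≢i

transpose-matchʳ : (i k : Fin n) → PC.transpose i k k ≡ i
transpose-matchʳ i k with k ≟ i
... | yes k≡i = k≡i
... | no _ with k ≟ k
...   | yes _  = refl
...   | no k≢k = contradiction refl k≢k

transpose-mismatch : {i k l : Fin n} → l ≢ i → l ≢ k → PC.transpose i k l ≡ l
transpose-mismatch {i = i} {k} {l} l≢i l≢k with l ≟ i
... | yes l≡i = contradiction l≡i l≢i
... | no _ with l ≟ k
...   | yes l≡k = contradiction l≡k l≢k
...   | no _    = refl

-- Recency.  Histories are reversed here (most recent request first), and
-- v ∉ segment u h says that u was requested more recently than v.

head∈segment : (u x : Fin n) (h : List (Fin n)) → x ∈ segment u (x ∷ h)
head∈segment u x h with x ≟ u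
... | yes _ = here refl
... | no  _ = here refl

∉segment-request : ∀ {u v x : Fin n} h → u ≢ x → v ∉ segment u (x ∷ h) → v ∉ segment u h
∉segment-request {u = u} {x = x} h u≢x v∉ with x ≟ u
... | yes refl = contradiction refl u≢x
... | no  _    = v∉ ∘ there

-- Scanning back from the latest request, `u` is met before the scan for `v` stops; the scan for `u`
-- therefore ends before reaching `v`.
∈segment⇒∉segment : ∀ {u v : Fin n} h → u ∈ segment v h → u ≢ v → v ∉ segment u h
∈segment⇒∉segment {u = u} {v} (x ∷ h) u∈ u≢v with x ≟ v | x ≟ u
∈segment⇒∉segment (x ∷ h) (here refl) u≢v | yes refl | _ = contradiction refl u≢v
∈segment⇒∉segment (x ∷ h) _           u≢v | no x≢v | yes refl = λ { (here refl) → x≢v refl }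
∈segment⇒∉segment (x ∷ h) (here refl) u≢v | no x≢v | no x≢u = contradiction refl x≢u
∈segment⇒∉segment (x ∷ h) (there u∈)  u≢v | no x≢v | no x≢u =
  λ { (here refl) → x≢v refl ; (there v∈) → ∈segment⇒∉segment h u∈ u≢v v∈ }

-- Both segments are prefixes of `h`, and the one of `u` stops before `v` is met, so it is the
-- shorter prefix.
∉segment⇒segment-⊆ : ∀ {u v : Fin n} h → v ∉ segment u h → segment u h ⊆ segment v h
∉segment⇒segment-⊆ {u = u} {v} (x ∷ h) v∉ y∈ with x ≟ u | x ≟ v
∉segment⇒segment-⊆ (x ∷ h) v∉ y∈          | yes _ | yes refl = contradiction (here refl) v∉
∉segment⇒segment-⊆ (x ∷ h) v∉ (here refl) | yes _ | no _     = here refl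
∉segment⇒segment-⊆ (x ∷ h) v∉ y∈          | no _  | yes refl = contradiction (here refl) v∉
∉segment⇒segment-⊆ (x ∷ h) v∉ (here refl) | no _  | no _     = here refl
∉segment⇒segment-⊆ (x ∷ h) v∉ (there y∈)  | no _  | no _     = there (∉segment⇒segment-⊆ h (v∉ ∘ there) y∈)

-- The body of `rank` with the reversal already done, so `rank h v` is definitionally
-- `rankʳ (reverse h) v`.
rankʳ : List (Fin n) → Fin n → ℕ
rankʳ h v = length (deduplicate _≟_ (segment v h))

rankʳ≤ : ∀ h (v : Fin n) ys → segment v h ⊆ ys → rankʳ h v ≤ length ys
rankʳ≤ h v ys seg⊆ = unique-⊆⇒length≤ (deduplicate-! _≟_ (segment v h)) (seg⊆ ∘ ∈-deduplicate⁻ _≟_ (segment v h))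

rankʳ-mono : ∀ {u v : Fin n} h → v ∉ segment u h → rankʳ h u ≤ rankʳ h v
rankʳ-mono {u = u} {v} h v∉ = rankʳ≤ h u _ (∈-deduplicate⁺ _≟_ ∘ ∉segment⇒segment-⊆ h v∉)

-- The potential

-- An inversion between recency and depth. The strict inequality ignores pairs on one level, whose
-- order an MRU tree leaves open.
Bad : List (Fin n) → Tree n → Fin n → Pred (Fin n) 0ℓ
Bad h π v u = v ∉ segment u h × itemDepth π v < itemDepth π u

Bad? : ∀ h (π : Tree n) v → Decidable (Bad h π v)
Bad? h π v u = ¬? (_∈?_ _≟_ v (segment u h)) ×-dec (itemDepth π v <? itemDepth π u)

weight : List (Fin n) → Tree n → Fin n → ℕ
weight h π v = 2 ^ itemDepth π v + count (Bad? h π v)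

Φ : List (Fin n) → Tree n → ℕ
Φ h π = Π (weight h π)

Φ₀ : ℕ → ℕ
Φ₀ n = Π {n} (λ s → 2 ^ depth s)

-- Dropping the counts leaves the product of `2 ^ depth` over all servers, merely reordered by `π`.
Φ₀≤Φ : ∀ h (π : Tree n) → Φ₀ n ≤ Φ h π
Φ₀≤Φ {n} h π = begin
  Φ₀ n                              ≡⟨ Π-permute π (λ s → 2 ^ depth s) ⟨
  Π (λ v → 2 ^ itemDepth π v)       ≤⟨ Π-mono (allFin n) (λ _ → m≤m+n _ _) ⟩
  Φ h π                             ∎
  where open ≤-Reasoning

-- A more recent item has no larger rank, so in an MRU tree it is no deeper and every count
-- vanishes.
MRU⇒Φ≤Φ₀ : ∀ h (π : Tree n) → (∀ v → itemDepth π v ≡ ⌊log₂ (rankʳ h v) ⌋) → Φ h π ≤ Φ₀ n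
MRU⇒Φ≤Φ₀ {n} h π mru = begin
  Φ h π                             ≤⟨ Π-mono (allFin n) (λ {v} _ → no-bad v) ⟩
  Π (λ v → 2 ^ itemDepth π v)       ≡⟨ Π-permute π (λ s → 2 ^ depth s) ⟩
  Φ₀ n                              ∎
  where
  open ≤-Reasoning
  no-bad : ∀ v → weight h π v ≤ 2 ^ itemDepth π v
  no-bad v = begin
    weight h π v           ≤⟨ +-monoʳ-≤ _ (count-⊆ (Bad? h π v) [] λ u (v∉ , dv<du) → contradiction
                                (subst₂ _≤_ (sym (mru u)) (sym (mru v)) (⌊log₂⌋-mono-≤ (rankʳ-mono h v∉)))
                                (<⇒≱ dv<du)) ⟩
    2 ^ itemDepth π v + 0  ≡⟨ +-identityʳ _ ⟩
    2 ^ itemDepth π v      ∎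

-- Effect of one request on the potential.

module Request (h : List (Fin n)) (π : Tree n) (x : Fin n) where
  open ≤-Reasoning

  d : ℕ
  d = itemDepth π x

  -- Upper bounds on the new weights, reached one level at a time from i = 0 to i = d.
  raised : ℕ → Fin n → ℕ
  raised i = bump (λ v → itemDepth π v <? i) (weight h π)

  -- Level `i` holds at most `2 ^ i` items, each of weight at least `2 ^ i`, so `Π-increment`
  -- applies with `N = 2 ^ i`.
  raise-level : ∀ i → Π (raised (suc i)) ≤ 4 * Π (raised i)
  raise-level i = Π-increment (λ v → itemDepth π v ≟ℕ i) off (2 ^ i) {{m^n≢0 2 i}}
    (λ { v refl → ≤-trans (m≤m+n _ _) (f≤bump (λ v → itemDepth π v <? i) (weight h π) v) })
    (λ v _ → ≤-trans (bump≤suc (λ v → itemDepth π v <? suc i) (weight h π) v)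
               (s≤s (f≤bump (λ v → itemDepth π v <? i) (weight h π) v)))
    (allFin n) (level-size π i)
    where
    off : ∀ v → itemDepth π v ≢ i → raised (suc i) v ≤ raised i v
    off v ≢i = bump-mono (λ v → itemDepth π v <? suc i) (λ v → itemDepth π v <? i) (weight h π)
      λ d<1+i → ≤∧≢⇒< (s≤s⁻¹ d<1+i) ≢i

  raised≤ : ∀ i → Π (raised i) ≤ 2 ^ (2 * i) * Φ h π
  raised≤ zero    = ≤-reflexive (sym (+-identityʳ _))
  raised≤ (suc i) = begin
    Π (raised (suc i))                   ≤⟨ raise-level i ⟩
    4 * Π (raised i)                     ≤⟨ *-monoʳ-≤ 4 (raised≤ i) ⟩
    4 * (2 ^ (2 * i) * Φ h π)            ≡⟨ *-assoc 4 (2 ^ (2 * i)) _ ⟨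
    4 * 2 ^ (2 * i) * Φ h π              ≡⟨ cong (_* Φ h π) (^-distribˡ-+-* 2 2 (2 * i)) ⟨
    2 ^ (2 + 2 * i) * Φ h π              ≡⟨ cong (λ k → 2 ^ k * Φ h π) (*-suc 2 i) ⟨
    2 ^ (2 * suc i) * Φ h π              ∎

  -- The request moves only `x` forward in the recency order, so `x` is the only possible new bad
  -- item.
  bad-request : ∀ v u → Bad (x ∷ h) π v u → u ∈ x ∷ filter (Bad? h π v) (allFin n)
  bad-request v u (v∉ , dv<du) with u ≟ x
  ... | yes refl = here refl
  ... | no u≢x   = there (∈-filter-allFin (Bad? h π v) (∉segment-request h u≢x v∉ , dv<du))

  -- From depth `d` on, not even `x` is new, because it is not strictly deeper than `v`.
  bad-request-deep : ∀ v u → d ≤ itemDepth π v → Bad (x ∷ h) π v u → Bad h π v u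
  bad-request-deep v u d≤dv (v∉ , dv<du) =
    ∉segment-request h (λ { refl → <⇒≱ dv<du d≤dv }) v∉ , dv<du

  weight-off : ∀ v → v ≢ x → weight (x ∷ h) π v ≤ raised d v
  weight-off v _ with itemDepth π v <? d
  ... | yes dv<d = begin
    weight (x ∷ h) π v                                 ≤⟨ +-monoʳ-≤ (2 ^ itemDepth π v) (count-⊆ (Bad? (x ∷ h) π v) _ (bad-request v)) ⟩
    2 ^ itemDepth π v + suc (count (Bad? h π v))       ≡⟨ +-suc _ _ ⟩
    suc (weight h π v)                                 ≤⟨ bump-on (λ v → itemDepth π v <? d) (weight h π) dv<d ⟩
    raised d v                                         ∎
  ... | no dv≮d = begin
    weight (x ∷ h) π v    ≤⟨ +-monoʳ-≤ (2 ^ itemDepth π v) (count-⊆ (Bad? (x ∷ h) π v) _ λ u bad →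
                               ∈-filter-allFin (Bad? h π v) (bad-request-deep v u (≮⇒≥ dv≮d) bad)) ⟩
    weight h π v          ≤⟨ f≤bump (λ v → itemDepth π v <? d) (weight h π) v ⟩
    raised d v            ∎

  -- An item in the segment of `x` is either deeper than `x`, hence bad for `x`, or among the top
  -- `suc d` levels, `x` included.
  rank-bound : rankʳ h x ≤ count (Bad? h π x) + (2 ^ suc d ∸ 1)
  rank-bound = begin
    rankʳ h x                        ≤⟨ rankʳ≤ h x (bads ++ shallow) seg⊆ ⟩
    length (bads ++ shallow)         ≡⟨ length-++ bads ⟩
    length bads + length shallow     ≤⟨ +-monoʳ-≤ (length bads) (top-size π d) ⟩
    length bads + (2 ^ suc d ∸ 1)    ∎
    where
    bads    = filter (Bad? h π x) (allFin n)
    shallow = filter (λ v → itemDepth π v ≤? d) (allFin n)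
    seg⊆ : segment x h ⊆ bads ++ shallow
    seg⊆ {u} u∈ with itemDepth π u ≤? d
    ... | yes du≤d = ∈-++⁺ʳ bads (∈-filter-allFin (λ v → itemDepth π v ≤? d) du≤d)
    ... | no du≰d  = ∈-++⁺ˡ (∈-filter-allFin (Bad? h π x)
                       (∈segment⇒∉segment h u∈ (λ { refl → du≰d ≤-refl }) , ≰⇒> du≰d))

  -- At the root the rank exceeds the number of bad pairs by at most 1, so no
  -- constant is lost; elsewhere the factor 2 ^ d absorbs it.
  2^⌊log₂rank⌋≤ : 2 ^ ⌊log₂ (rankʳ h x) ⌋ ≤ 2 ^ d * weight h π x
  2^⌊log₂rank⌋≤ = 2^⌊log₂⌋≤ (2 ^ d * weight h π x) (*-mono-≤ (m^n>0 2 d) (≤-trans (m^n>0 2 d) (m≤m+n _ _)))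
    (≤-trans rank-bound (bound d (count (Bad? h π x))))
    where
    -- Positivity of `m` handles `k = 0`, where the left side is `1`.
    2^⌊log₂⌋≤ : ∀ {k} m → 0 < m → k ≤ m → 2 ^ ⌊log₂ k ⌋ ≤ m
    2^⌊log₂⌋≤ (suc m) _ k≤m = ≤-trans (^-monoʳ-≤ 2 (⌊log₂⌋-mono-≤ k≤m)) (2^⌊log₂n⌋≤n m)
    bound : ∀ e b → b + (2 ^ suc e ∸ 1) ≤ 2 ^ e * (2 ^ e + b)
    bound zero    b = ≤-reflexive (trans (+-comm b 1) (sym (+-identityʳ (suc b))))
    bound (suc e) b = begin
      b + (2 ^ (2 + e) ∸ 1)             ≤⟨ +-mono-≤ (m≤m+n b (b + 0)) (m∸n≤m _ 1) ⟩
      2 * b + 2 * 2 ^ suc e             ≡⟨ regroup b (2 ^ suc e) ⟩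
      2 * (2 ^ suc e + b)               ≤⟨ *-monoˡ-≤ (2 ^ suc e + b) (^-monoʳ-≤ 2 {1} {suc e} (s≤s z≤n)) ⟩
      2 ^ suc e * (2 ^ suc e + b)       ∎
      where
      regroup : ∀ a c → 2 * a + 2 * c ≡ 2 * (c + a)
      regroup = solve-∀

  -- No item is more recent than the one just requested: `x` heads every segment of `x ∷ h`.
  weight-at : weight (x ∷ h) π x ≤ 2 ^ d
  weight-at = begin
    weight (x ∷ h) π x  ≤⟨ +-monoʳ-≤ (2 ^ d) (count-⊆ (Bad? (x ∷ h) π x) [] λ u (x∉ , _) →
                             contradiction (head∈segment u x h) x∉) ⟩
    2 ^ d + 0           ≡⟨ +-identityʳ _ ⟩
    2 ^ d               ∎

  -- The exponent `4 * d` splits evenly. Half is spent at `x`: `2 ^ d` from the rank bound and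
  -- `2 ^ d` as its new weight. Half pays for the `d` raised levels, a factor `4` each.
  Φ-request : 2 ^ ⌊log₂ (rankʳ h x) ⌋ * Φ (x ∷ h) π ≤ 2 ^ (4 * d) * Φ h π
  Φ-request = begin
    2 ^ ⌊log₂ (rankʳ h x) ⌋ * Φ (x ∷ h) π     ≤⟨ Π-point (2 ^ ⌊log₂ (rankʳ h x) ⌋) (2 ^ (2 * d)) (∈-allFin x) (allFin⁺ n) at-x weight-off ⟩
    2 ^ (2 * d) * Π (raised d)                ≤⟨ *-monoʳ-≤ (2 ^ (2 * d)) (raised≤ d) ⟩
    2 ^ (2 * d) * (2 ^ (2 * d) * Φ h π)       ≡⟨ *-assoc (2 ^ (2 * d)) (2 ^ (2 * d)) _ ⟨
    2 ^ (2 * d) * 2 ^ (2 * d) * Φ h π         ≡⟨ cong (_* Φ h π) (^-distribˡ-+-* 2 (2 * d) (2 * d)) ⟨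
    2 ^ (2 * d + 2 * d) * Φ h π               ≡⟨ cong (λ k → 2 ^ k * Φ h π) (*-distribʳ-+ d 2 2) ⟨
    2 ^ (4 * d) * Φ h π                       ∎
    where
    regroup : ∀ a b → a * b * a ≡ a * a * b
    regroup = solve-∀
    at-x : 2 ^ ⌊log₂ (rankʳ h x) ⌋ * weight (x ∷ h) π x ≤ 2 ^ (2 * d) * raised d x
    at-x = begin
      2 ^ ⌊log₂ (rankʳ h x) ⌋ * weight (x ∷ h) π x  ≤⟨ *-mono-≤ 2^⌊log₂rank⌋≤ weight-at ⟩
      2 ^ d * weight h π x * 2 ^ d                  ≡⟨ regroup (2 ^ d) _ ⟩
      2 ^ d * 2 ^ d * weight h π x                  ≡⟨ cong (_* weight h π x) (^-distribˡ-+-* 2 d d) ⟨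
      2 ^ (d + d) * weight h π x                    ≡⟨ cong (λ k → 2 ^ (d + k) * weight h π x) (+-identityʳ d) ⟨
      2 ^ (2 * d) * weight h π x                    ≤⟨ *-monoʳ-≤ (2 ^ (2 * d)) (f≤bump (λ v → itemDepth π v <? d) (weight h π) x) ⟩
      2 ^ (2 * d) * raised d x                      ∎

-- Effect of one swap on the potential.

module SwapStep (h : List (Fin n)) (π : Tree n) (sw : Swap n) where
  open ≤-Reasoning
  open Swap sw using () renaming (server to s)

  p : Fin n
  p = parent sw

  j : ℕ
  j = depth p

  depth-child : depth s ≡ suc j
  depth-child = trans (heap-depth (toℕ s) (Swap.nonRoot sw))
    (cong (λ i → suc ⌊log₂ (suc i) ⌋) (sym (toℕ-fromℕ< (parentIdx<n s))))

  π′ : Tree n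
  π′ = π ∘ₚ transpose s p

  child↑ parent↓ : Fin n
  child↑  = π ⟨$⟩ˡ s
  parent↓ = π ⟨$⟩ˡ p

  swapped : List (Fin n)
  swapped = child↑ ∷ parent↓ ∷ []

  -- A view of an item by its depths before and after the swap, so that the case analyses below need
  -- not compare servers.
  data Moved (v : Fin n) : Set where
    rise : v ≡ child↑  → itemDepth π v ≡ suc j → itemDepth π′ v ≡ j     → Moved v
    fall : v ≡ parent↓ → itemDepth π v ≡ j     → itemDepth π′ v ≡ suc j → Moved v
    stay : v ∉ swapped → itemDepth π′ v ≡ itemDepth π v → Moved v

  moved : ∀ v → Moved v
  moved v with π ⟨$⟩ʳ v ≟ s | π ⟨$⟩ʳ v ≟ p
  ... | yes πv≡s | _ = rise (sym (trans (cong (π ⟨$⟩ˡ_) (sym πv≡s)) (inverseˡ π)))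
    (trans (cong depth πv≡s) depth-child)
    (cong depth (trans (cong (PC.transpose s p) πv≡s) (transpose-matchˡ s p)))
  ... | no _ | yes πv≡p = fall (sym (trans (cong (π ⟨$⟩ˡ_) (sym πv≡p)) (inverseˡ π)))
    (cong depth πv≡p)
    (trans (cong depth (trans (cong (PC.transpose s p) πv≡p) (transpose-matchʳ s p))) depth-child)
  ... | no πv≢s | no πv≢p = stay
    (λ { (here refl) → πv≢s (inverseʳ π) ; (there (here refl)) → πv≢p (inverseʳ π) })
    (cong depth (transpose-mismatch πv≢s πv≢p))

  bads : Fin n → List (Fin n)
  bads v = filter (Bad? h π v) (allFin n)

  level? : Decidable (λ v → itemDepth π′ v ≡ suc j)
  level? v = itemDepth π′ v ≟ℕ suc j

  -- An item risen to level `j` newly sees at most the items now on level `suc j`; anything deeper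
  -- did not move and was already below it.
  bad-rise : ∀ {v} → itemDepth π v ≡ suc j → itemDepth π′ v ≡ j →
             ∀ u → Bad h π′ v u → u ∈ bads v ++ filter level? (allFin n)
  bad-rise {v} dv d′v u (v∉ , d′v<d′u) with level? u | moved u
  ... | yes d′u | _              = ∈-++⁺ʳ (bads v) (∈-filter-allFin level? d′u)
  ... | no _    | rise _ _ d′u   = contradiction (subst₂ _<_ d′v d′u d′v<d′u) 1+n≰n
  ... | no d′u≢ | fall _ _ d′u   = contradiction d′u d′u≢
  ... | no d′u≢ | stay _ d′u≡du  = ∈-++⁺ˡ (∈-filter-allFin (Bad? h π v) (v∉ ,
    subst₂ _<_ (sym dv) d′u≡du (≤∧≢⇒< (subst (_< itemDepth π′ u) d′v d′v<d′u) (d′u≢ ∘ sym))))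

  -- Whatever lies below level `suc j` after the swap did not move, so it was below level `j`
  -- before.
  bad-fall : ∀ {v} → itemDepth π v ≡ j → itemDepth π′ v ≡ suc j →
             ∀ u → Bad h π′ v u → u ∈ bads v
  bad-fall {v} dv d′v u (v∉ , d′v<d′u) with moved u
  ... | rise _ _ d′u  = contradiction (subst₂ _<_ d′v d′u d′v<d′u) (<⇒≯ ≤-refl)
  ... | fall _ _ d′u  = contradiction (subst₂ _<_ d′v d′u d′v<d′u) 1+n≰n
  ... | stay _ d′u≡du = ∈-filter-allFin (Bad? h π v) (v∉ ,
    subst₂ _<_ (sym dv) d′u≡du (<-trans ≤-refl (subst (_< itemDepth π′ u) d′v d′v<d′u)))

  -- Only `parent↓` gets deeper, from `j` to `suc j`, and this changes a comparison only with items
  -- on level `j`.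
  bad-stay : ∀ {v} → itemDepth π′ v ≡ itemDepth π v →
             ∀ u → Bad h π′ v u → u ∈ bads v ⊎ (u ≡ parent↓ × itemDepth π v ≡ j)
  bad-stay {v} d′v≡dv u (v∉ , d′v<d′u) with moved u | itemDepth π v ≟ℕ j
  ... | rise _ du d′u   | _      = inj₁ (∈-filter-allFin (Bad? h π v) (v∉ ,
    subst (itemDepth π v <_) (sym du) (<-trans (subst₂ _<_ d′v≡dv d′u d′v<d′u) ≤-refl)))
  ... | fall u≡ _ _     | yes dv = inj₂ (u≡ , dv)
  ... | fall _ du d′u   | no dv≢ = inj₁ (∈-filter-allFin (Bad? h π v) (v∉ ,
    subst (itemDepth π v <_) (sym du) (≤∧≢⇒< (s≤s⁻¹ (subst₂ _<_ d′v≡dv d′u d′v<d′u)) dv≢)))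
  ... | stay _ d′u≡du   | _      = inj₁ (∈-filter-allFin (Bad? h π v) (v∉ ,
    subst₂ _<_ d′v≡dv d′u≡du d′v<d′u))

  on-level? : Decidable (λ v → itemDepth π v ≡ j)
  on-level? v = itemDepth π v ≟ℕ j

  raised : Fin n → ℕ
  raised = bump on-level? (weight h π)

  weight-on : ∀ v → v ∈ swapped → weight h π′ v ≤ 2 * raised v
  weight-on v v∈ with moved v
  ... | stay v∉ _     = contradiction v∈ v∉
  ... | rise _ dv d′v = begin
    2 ^ itemDepth π′ v + count (Bad? h π′ v)   ≡⟨ cong (λ k → 2 ^ k + count (Bad? h π′ v)) d′v ⟩
    2 ^ j + count (Bad? h π′ v)                ≤⟨ +-monoʳ-≤ (2 ^ j) (count-⊆ (Bad? h π′ v) _ (bad-rise dv d′v)) ⟩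
    2 ^ j + length (bads v ++ filter level? (allFin n))
                                               ≡⟨ cong (2 ^ j +_) (length-++ (bads v)) ⟩
    2 ^ j + (length (bads v) + count level?)   ≤⟨ +-monoʳ-≤ (2 ^ j) (+-monoʳ-≤ (length (bads v)) (level-size π′ (suc j))) ⟩
    -- The slack `2 ^ j + length (bads v)` completes the sum to exactly twice the old weight.
    2 ^ j + (length (bads v) + 2 ^ suc j)      ≤⟨ m≤m+n _ (2 ^ j + length (bads v)) ⟩
    2 ^ j + (length (bads v) + 2 ^ suc j) + (2 ^ j + length (bads v))
                                               ≡⟨ regroup (2 ^ j) (length (bads v)) ⟩
    2 * (2 ^ suc j + length (bads v))          ≡⟨ cong (λ k → 2 * (2 ^ k + length (bads v))) dv ⟨
    2 * weight h π v                           ≤⟨ *-monoʳ-≤ 2 (f≤bump on-level? (weight h π) v) ⟩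
    2 * raised v                               ∎
    where
    regroup : ∀ a b → a + (b + 2 * a) + (a + b) ≡ 2 * (2 * a + b)
    regroup = solve-∀
  ... | fall _ dv d′v = begin
    2 ^ itemDepth π′ v + count (Bad? h π′ v)   ≡⟨ cong (λ k → 2 ^ k + count (Bad? h π′ v)) d′v ⟩
    2 ^ suc j + count (Bad? h π′ v)            ≤⟨ +-monoʳ-≤ (2 ^ suc j) (count-⊆ (Bad? h π′ v) _ (bad-fall dv d′v)) ⟩
    2 ^ suc j + length (bads v)                ≤⟨ +-monoʳ-≤ (2 ^ suc j) (m≤n*m (length (bads v)) 2) ⟩
    2 * 2 ^ j + 2 * length (bads v)            ≡⟨ *-distribˡ-+ 2 (2 ^ j) _ ⟨
    2 * (2 ^ j + length (bads v))              ≡⟨ cong (λ k → 2 * (2 ^ k + length (bads v))) dv ⟨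
    2 * weight h π v                           ≤⟨ *-monoʳ-≤ 2 (f≤bump on-level? (weight h π) v) ⟩
    2 * raised v                               ∎

  -- By `bad-stay` an unmoved item gains at most the single bad item `parent↓`, and only on level
  -- `j`, where `raised` has room for it.
  weight-off : ∀ v → v ∉ swapped → weight h π′ v ≤ raised v
  weight-off v v∉ with moved v
  ... | rise v≡ _ _   = contradiction (here v≡) v∉
  ... | fall v≡ _ _   = contradiction (there (here v≡)) v∉
  ... | stay _ d′v≡dv with on-level? v
  ...   | yes dv = begin
    2 ^ itemDepth π′ v + count (Bad? h π′ v)   ≤⟨ +-monoʳ-≤ _ (count-⊆ (Bad? h π′ v) (parent↓ ∷ bads v) λ u bad →
                                                    [ there , here ∘ proj₁ ]′ (bad-stay d′v≡dv u bad)) ⟩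
    2 ^ itemDepth π′ v + suc (length (bads v)) ≡⟨ cong (λ k → 2 ^ k + suc (length (bads v))) d′v≡dv ⟩
    2 ^ itemDepth π v + suc (length (bads v))  ≡⟨ +-suc _ _ ⟩
    suc (weight h π v)                         ≤⟨ bump-on on-level? (weight h π) dv ⟩
    raised v                                   ∎
  ...   | no dv≢ = begin
    2 ^ itemDepth π′ v + count (Bad? h π′ v)   ≤⟨ +-monoʳ-≤ _ (count-⊆ (Bad? h π′ v) (bads v) λ u bad →
                                                    [ id , (λ (_ , dv) → contradiction dv dv≢) ]′ (bad-stay d′v≡dv u bad)) ⟩
    2 ^ itemDepth π′ v + length (bads v)       ≡⟨ cong (λ k → 2 ^ k + length (bads v)) d′v≡dv ⟩
    weight h π v                               ≤⟨ f≤bump on-level? (weight h π) v ⟩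
    raised v                                   ∎

  Φ-swap : Φ h π′ ≤ 16 * Φ h π
  Φ-swap = begin
    Φ h π′                                     ≤⟨ Π-double swapped? weight-off weight-on (allFin n) ⟩
    -- The first `4` is `2 ^ 2` for the two moved items, the second comes from the raised level `j`.
    2 ^ count swapped? * Π raised              ≤⟨ *-mono-≤ (^-monoʳ-≤ 2 (count-⊆ swapped? swapped λ _ → id)) raised≤ ⟩
    4 * (4 * Φ h π)                            ≡⟨ *-assoc 4 4 (Φ h π) ⟨
    16 * Φ h π                                 ∎
    where
    swapped? : Decidable (_∈ swapped)
    swapped? v = _∈?_ _≟_ v swapped
    raised≤ : Π raised ≤ 4 * Φ h π
    raised≤ = Π-increment on-level? (λ v → bump-off on-level? (weight h π)) (2 ^ j) {{m^n≢0 2 j}}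
      (λ v dv → subst (λ k → 2 ^ k ≤ weight h π v) dv (m≤m+n _ _))
      (λ v _ → bump≤suc on-level? (weight h π) v) (allFin n) (level-size π j)

-- Sequences of swaps.

swaps : Tree n → List (Swap n) → Tree n
swaps π []         = π
swaps π (sw ∷ sws) = swaps (π ∘ₚ transpose (Swap.server sw) (parent sw)) sws

-- The cost model moves bare location functions while the potential needs a bijection; a single swap
-- acts on both in definitionally the same way.
applySwaps≡swaps : (π : Tree n) (sws : List (Swap n)) → applySwaps (π ⟨$⟩ʳ_) sws ≡ (swaps π sws ⟨$⟩ʳ_)
applySwaps≡swaps π []         = refl
applySwaps≡swaps π (sw ∷ sws) = applySwaps≡swaps (π ∘ₚ transpose (Swap.server sw) (parent sw)) sws

Φ-swaps : ∀ h (π : Tree n) sws → Φ h (swaps π sws) ≤ 2 ^ (4 * length sws) * Φ h π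
Φ-swaps h π []         = ≤-reflexive (sym (+-identityʳ _))
Φ-swaps h π (sw ∷ sws) = begin
  Φ h (swaps π′ sws)                      ≤⟨ Φ-swaps h π′ sws ⟩
  2 ^ (4 * length sws) * Φ h π′           ≤⟨ *-monoʳ-≤ (2 ^ (4 * length sws)) (SwapStep.Φ-swap h π sw) ⟩
  2 ^ (4 * length sws) * (16 * Φ h π)     ≡⟨ regroup (2 ^ (4 * length sws)) _ ⟩
  16 * 2 ^ (4 * length sws) * Φ h π       ≡⟨ cong (_* Φ h π) (^-distribˡ-+-* 2 4 (4 * length sws)) ⟨
  2 ^ (4 + 4 * length sws) * Φ h π        ≡⟨ cong (λ k → 2 ^ k * Φ h π) (*-suc 4 (length sws)) ⟨
  2 ^ (4 * length (sw ∷ sws)) * Φ h π     ∎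
  where
  open ≤-Reasoning
  π′ = π ∘ₚ transpose (Swap.server sw) (parent sw)
  regroup : ∀ a b → a * (16 * b) ≡ 16 * a * b
  regroup = solve-∀

-- Amortization over the request sequence.

module _ (init : List (Fin n)) (alg : OnlineAlg n) (mru : HasMRU init alg) where
  open ≤-Reasoning

  -- The exponential form of the usual potential argument. The past `p` and the offline tree `π` are
  -- arbitrary so that the induction can advance to the next request; the empty sequence is settled
  -- by `Φ₀≤Φ`.
  amortized : ∀ p (π : Tree n) (sched : ℕ → List (Swap n)) t σ →
    2 ^ accessCostFrom alg p σ * Φ₀ n ≤
    2 ^ (4 * offlineCostFrom (π ⟨$⟩ʳ_) sched t σ) * Φ (reverse (init ++ p)) π
  amortized p π sched t []      = *-monoʳ-≤ 1 (Φ₀≤Φ (reverse (init ++ p)) π)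
  amortized p π sched t (x ∷ σ) rewrite applySwaps≡swaps π (sched t) = begin
    2 ^ (M + R) * Φ₀ n                            ≡⟨ cong (_* Φ₀ n) (^-distribˡ-+-* 2 M R) ⟩
    2 ^ M * 2 ^ R * Φ₀ n                          ≡⟨ *-assoc (2 ^ M) (2 ^ R) _ ⟩
    2 ^ M * (2 ^ R * Φ₀ n)                        ≤⟨ *-monoʳ-≤ (2 ^ M) ih ⟩
    2 ^ M * (2 ^ (4 * O) * Φ (x ∷ h) π′)          ≡⟨ x∙yz≈y∙xz (2 ^ M) (2 ^ (4 * O)) _ ⟩
    -- The MRU property enters here: the access cost `M` is the logarithm of the rank of `x`, which
    -- `Φ-request` can charge.
    2 ^ (4 * O) * (2 ^ M * Φ (x ∷ h) π′)          ≡⟨ cong (λ k → 2 ^ (4 * O) * (2 ^ k * Φ (x ∷ h) π′)) (mru p x) ⟩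
    2 ^ (4 * O) * (2 ^ ⌊log₂ (rankʳ h x) ⌋ * Φ (x ∷ h) π′)
                                                  ≤⟨ *-monoʳ-≤ (2 ^ (4 * O)) (Request.Φ-request h π′ x) ⟩
    2 ^ (4 * O) * (2 ^ (4 * d) * Φ h π′)          ≤⟨ *-monoʳ-≤ (2 ^ (4 * O)) (*-monoʳ-≤ (2 ^ (4 * d)) (Φ-swaps h π (sched t))) ⟩
    2 ^ (4 * O) * (2 ^ (4 * d) * (2 ^ (4 * S) * Φ h π))
                                                  ≡⟨ regroup₃ (2 ^ (4 * O)) (2 ^ (4 * d)) (2 ^ (4 * S)) _ ⟩
    2 ^ (4 * S) * 2 ^ (4 * d) * 2 ^ (4 * O) * Φ h π
                                                  ≡⟨ cong (_* Φ h π) powers ⟨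
    2 ^ (4 * (S + d + O)) * Φ h π                 ∎
    where
    h  = reverse (init ++ p)
    π′ = swaps π (sched t)
    M  = itemDepth (alg p) x
    R  = accessCostFrom alg (p ++ [ x ]) σ
    O  = offlineCostFrom (π′ ⟨$⟩ʳ_) sched (suc t) σ
    S  = length (sched t)
    d  = itemDepth π′ x
    -- A request appended to the oldest-first history becomes the head after reversal.
    next : reverse (init ++ (p ++ [ x ])) ≡ x ∷ h
    next = trans (cong reverse (sym (++-assoc init p [ x ]))) (reverse-++ (init ++ p) [ x ])
    ih : 2 ^ R * Φ₀ n ≤ 2 ^ (4 * O) * Φ (x ∷ h) π′
    ih = subst (λ l → 2 ^ R * Φ₀ n ≤ 2 ^ (4 * O) * Φ l π′) next (amortized (p ++ [ x ]) π′ sched (suc t) σ)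
    regroup₃ : ∀ a b c e → a * (b * (c * e)) ≡ c * b * a * e
    regroup₃ = solve-∀
    powers : 2 ^ (4 * (S + d + O)) ≡ 2 ^ (4 * S) * 2 ^ (4 * d) * 2 ^ (4 * O)
    powers = begin-equality
      2 ^ (4 * (S + d + O))                       ≡⟨ cong (2 ^_) (trans (*-distribˡ-+ 4 (S + d) O) (cong (_+ 4 * O) (*-distribˡ-+ 4 S d))) ⟩
      2 ^ (4 * S + 4 * d + 4 * O)                 ≡⟨ ^-distribˡ-+-* 2 (4 * S + 4 * d) (4 * O) ⟩
      2 ^ (4 * S + 4 * d) * 2 ^ (4 * O)           ≡⟨ cong (_* 2 ^ (4 * O)) (^-distribˡ-+-* 2 (4 * S) (4 * d)) ⟩
      2 ^ (4 * S) * 2 ^ (4 * d) * 2 ^ (4 * O)     ∎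

-- Cancelling the constant and comparing exponents.

Φ₀-nonZero : ∀ n → NonZero (Φ₀ n)
Φ₀-nonZero n = product≢0 (All.tabulate positive)
  where
  positive : ∀ {m} → m ∈ map (λ s → 2 ^ depth s) (allFin n) → NonZero m
  positive m∈ with ∈-map⁻ _ m∈
  ... | s , _ , refl = m^n≢0 2 (depth s)

theorem4 : ∀ {n} (init : List (Fin n)) → (∀ v → v ∈ init) →
    (alg : OnlineAlg n) → HasMRU init alg →
    ∀ (σ : List (Fin n)) (sched : ℕ → List (Swap n)) →
    accessCost alg σ ≤ 4 * offlineCost (alg [] ⟨$⟩ʳ_) sched σ
theorem4 {n} init _ alg mru σ sched =
  -- Both algorithms start in `alg []`, which is MRU for `init`; the initial potential is thus at
  -- most `Φ₀ n`, and it cancels without an additive term.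
  ^-cancelʳ-≤ _ _ (*-cancelʳ-≤ _ _ (Φ₀ n) {{Φ₀-nonZero n}} (begin
    2 ^ accessCost alg σ * Φ₀ n                   ≤⟨ amortized init alg mru [] (alg []) sched 0 σ ⟩
    2 ^ (4 * cost) * Φ (reverse (init ++ [])) (alg [])
                                                  ≤⟨ *-monoʳ-≤ (2 ^ (4 * cost)) (MRU⇒Φ≤Φ₀ (reverse (init ++ [])) (alg []) (mru [])) ⟩
    2 ^ (4 * cost) * Φ₀ n                         ∎))
  where
  open ≤-Reasoning
  cost = offlineCost (alg [] ⟨$⟩ʳ_) sched σ
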